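{- For every (possibly partial) Boolean function $f$, $\mathsf{CMM}(f)\leq \mathsf{CG}^{\mathrm{ns}}(f)$.
   Context: A (possibly partial) Boolean function on $n$ bits is $f:\{0,1\}^n\to\{0,1,*\}$; its domain is $f^{ -1}(0)\cup f^{ -1}(1)$. $[n]=\{1,\dots,n\}$. Certificate game for $f$: one player receives $x\in f^{ -1}(0)$, the other $y\in f^{ -1}(1)$; without communication each outputs an index in $[n]$; they win iff they output the same index $i$ and $x_i\ne y_i$. A non-signaling strategy is a family of probability distributions $p(\cdot,\cdot|x,y)$ on $[n]\times[n]$, for $x\in f^{ -1}(0),y\in f^{ -1}(1)$, such that $\sum_b p(a,b|x,y)=\sum_b p(a,b|x,y')$ and $\sum_a p(a,b|x,y)=\sum_a p(a,b|x',y)$ for all $x,x'\in f^{ -1}(0)$, $y,y'\in f^{ -1}(1)$, $a,b\in[n]$. The non-signaling certificate game complexity is $\mathsf{CG}^{\mathrm{ns}}(f)=\min_p\max_{x\in f^{ -1}(0),y\in f^{ -1}(1)}\Big(\sum_{i:x_i\ne y_i}p(i,i|x,y)\Big)^{ -1}$ over non-signaling strategies $p$. Classical adversary bound: $\mathsf{CMM}(f)=\min_{p}\max_{x,y:\,f(x)=1-f(y)}\Big(\sum_{i:x_i\neq y_i}\min\{p_x(i),p_y(i)\}\Big)^{ -1}$, where $p=\{p_x\}$ assigns to each $x$ in the domain of $f$ a probability distribution $p_x$ on $[n]$. Conventions: $1/0=+\infty$; a maximum over an empty set (constant $f$) is $0$. -}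

module Defs where

open import Algebra.Bundles using (CommutativeRing)
import Algebra.Construct.NaturalChoice.Min as Min
import Algebra.Definitions as AlgebraDefinitions
import Algebra.Properties.CommutativeMonoid.Sum as Sum
open import Data.Bool.Base using (Bool; true; false; not; if_then_else_)
import Data.Bool.Properties as Bool
open import Data.Fin.Base using (Fin)
open import Data.List.Base using (List; []; _∷_; _++_; map; mapMaybe; filter; cartesianProduct; cartesianProductWith)
import Data.List.Extrema as Extrema
open import Data.Maybe.Base as Maybe using (Maybe; just)
import Data.Maybe.Properties as Maybe
open import Data.Nat.Base using (ℕ; zero; suc)
open import Data.Product.Base using (∃; ∃₂; _×_; _,_; proj₁; proj₂)
open import Data.Vec.Base using (Vec; []; _∷_; lookup)
open import Level using (Level; _⊔_) renaming (suc to lsuc)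
open import Relation.Binary.Bundles using (TotalOrder)
open import Relation.Binary.Core using (Rel)
open import Relation.Binary.PropositionalEquality.Core using (_≡_)
open import Relation.Binary.Structures using (IsDecTotalOrder)
import Relation.Binary.Construct.Add.Supremum.Equality as SupremumEquality
import Relation.Binary.Construct.Add.Supremum.NonStrict as SupremumOrder
open import Relation.Nullary.Construct.Add.Supremum using (_⁺; ⊤⁺; [_])
open import Relation.Nullary.Decidable.Core using (yes; no; does; dec⇒maybe)
open import Relation.Nullary.Negation.Core using (¬_)

-- The standard library has no real numbers, so probabilities are taken in an
-- arbitrary ordered field; classically ℝ is an instance, and so is ℚ.
-- Deciding _≈_ and _≤_ is what makes max, min and the convention 1/0 = ∞
-- definable.
record OrderedField c ℓ₁ ℓ₂ : Set (lsuc (c ⊔ ℓ₁ ⊔ ℓ₂)) where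
  field
    commutativeRing : CommutativeRing c ℓ₁

  open CommutativeRing commutativeRing public
    using (Carrier; _≈_; _+_; _*_; -_; 0#; 1#; +-commutativeMonoid)

  open AlgebraDefinitions _≈_ using (Invertible)

  infix 4 _≤_
  field
    _≤_             : Rel Carrier ℓ₂
    isDecTotalOrder : IsDecTotalOrder _≈_ _≤_
    0≉1             : ¬ (0# ≈ 1#)
    invertible      : ∀ x → ¬ (x ≈ 0#) → Invertible 1# _*_ x
    +-monoˡ-≤       : ∀ {x y} z → x ≤ y → (x + z) ≤ (y + z)
    *-nonNegative   : ∀ {x y} → 0# ≤ x → 0# ≤ y → 0# ≤ (x * y)

  open IsDecTotalOrder isDecTotalOrder public
    using (_≟_; _≤?_; isTotalOrder)

  totalOrder : TotalOrder c ℓ₁ ℓ₂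
  totalOrder = record { isTotalOrder = isTotalOrder }

-- `nothing` plays the role of *, `false` of 0 and `true` of 1.
PartialBoolean : ℕ → Set
PartialBoolean n = Vec Bool n → Maybe Bool

bitStrings : ∀ n → List (Vec Bool n)
bitStrings zero    = [] ∷ []
bitStrings (suc n) = cartesianProductWith _∷_ (false ∷ true ∷ []) (bitStrings n)

module _ {n : ℕ} (f : PartialBoolean n) where

  Preimage : Bool → Set
  Preimage b = ∃ λ x → f x ≡ just b

  preimages : ∀ b → List (Preimage b)
  preimages b = mapMaybe
    (λ x → Maybe.map (x ,_) (dec⇒maybe (Maybe.≡-dec Bool._≟_ (f x) (just b))))
    (bitStrings n)

  Domain : Set
  Domain = ∃ Preimage

  value : Domain → Bool
  value = proj₁

  domain : List Domain
  domain = map (false ,_) (preimages false) ++ map (true ,_) (preimages true)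

  oppositePairs : List (Domain × Domain)
  oppositePairs =
    filter (λ (x , y) → value x Bool.≟ not (value y)) (cartesianProduct domain domain)

module Complexity {c ℓ₁ ℓ₂} (K : OrderedField c ℓ₁ ℓ₂) where

  open OrderedField K
  open Sum +-commutativeMonoid using (sum; sum-syntax)
  open Min totalOrder using (_⊓_)

  open SupremumEquality _≈_ public using (_≈⁺_)
  open SupremumOrder _≤_ public using (_≤⁺_; ≤⁺-isTotalOrder)

  -- ⊤⁺ is +∞.
  K∞ : Set c
  K∞ = Carrier ⁺

  totalOrder∞ : TotalOrder c (c ⊔ ℓ₁) (c ⊔ ℓ₂)
  totalOrder∞ = record { isTotalOrder = ≤⁺-isTotalOrder isTotalOrder }

  reciprocal : Carrier → K∞
  reciprocal x with x ≟ 0#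
  ... | yes _   = ⊤⁺
  ... | no  x≉0 = [ proj₁ (invertible x x≉0) ]

  -- All the maxima below are over families of reciprocals of nonnegative
  -- numbers, so starting from 0 only affects the empty family.
  maximum : List K∞ → K∞
  maximum = Extrema.max totalOrder∞ [ 0# ]

  IsMinimum : ∀ {a} {A : Set a} → (A → K∞) → K∞ → Set _
  IsMinimum v m = (∃ λ a → v a ≈⁺ m) × (∀ a → m ≤⁺ v a)

  sumDiffering : ∀ {n} → Vec Bool n → Vec Bool n → (Fin n → Carrier) → Carrier
  sumDiffering {n} x y w =
    ∑[ i < n ] (if does (lookup x i Bool.≟ lookup y i) then 0# else w i)

  record Distribution (n : ℕ) : Set (c ⊔ ℓ₁ ⊔ ℓ₂) where
    field
      prob        : Fin n → Carrier
      nonNegative : ∀ i → 0# ≤ prob i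
      total       : ∑[ i < n ] prob i ≈ 1#

  open Distribution

  record JointDistribution (n : ℕ) : Set (c ⊔ ℓ₁ ⊔ ℓ₂) where
    field
      prob        : Fin n → Fin n → Carrier
      nonNegative : ∀ a b → 0# ≤ prob a b
      total       : ∑[ a < n ] ∑[ b < n ] prob a b ≈ 1#

  module _ {n : ℕ} (f : PartialBoolean n) where

    record NonSignalingStrategy : Set (c ⊔ ℓ₁ ⊔ ℓ₂) where
      field
        joint : Preimage f false → Preimage f true → JointDistribution n

      p : Fin n → Fin n → Preimage f false → Preimage f true → Carrier
      p a b x y = JointDistribution.prob (joint x y) a b

      field
        marginalˡ : ∀ x y y′ a → ∑[ b < n ] p a b x y ≈ ∑[ b < n ] p a b x y′
        marginalʳ : ∀ x x′ y b → ∑[ a < n ] p a b x y ≈ ∑[ a < n ] p a b x′ y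

    CGⁿˢ-cost : NonSignalingStrategy → K∞
    CGⁿˢ-cost s = maximum (map
      (λ (x , y) → reciprocal (sumDiffering (proj₁ x) (proj₁ y) (λ i → p i i x y)))
      (cartesianProduct (preimages f false) (preimages f true)))
      where open NonSignalingStrategy s

    CMM-cost : (Domain f → Distribution n) → K∞
    CMM-cost p = maximum (map
      (λ (x , y) → reciprocal
        (sumDiffering (proj₁ (proj₂ x)) (proj₁ (proj₂ y)) (λ i → prob (p x) i ⊓ prob (p y) i)))
      (oppositePairs f))

    -- The minima are relations rather than functions into K∞, because K is not
    -- assumed complete.  They are values of linear programs over K, hence
    -- attained, except that for n = 0 there is no distribution on [n].
    IsCGⁿˢ : K∞ → Set _
    IsCGⁿˢ = IsMinimum CGⁿˢ-cost

    IsCMM : K∞ → Set _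
    IsCMM = IsMinimum CMM-cost

{-# OPTIONS --safe #-}
-- Fix a 0-input x₀ and a 1-input y₀.  Let p_x be the first player's marginal
-- of p(·,·|x,y₀) and p_y the second player's marginal of p(·,·|x₀,y).  By
-- non-signaling these are also marginals of p(·,·|x,y), so both p_x(i) and
-- p_y(i) are at least p(i,i|x,y), hence so is their minimum.
module Submission where

open import Defs
open import Algebra.Bundles using (CommutativeRing)
import Algebra.Construct.NaturalChoice.Min as Min
import Algebra.Properties.CommutativeMonoid.Sum as Sum
import Algebra.Properties.Ring as RingProperties
open import Data.Bool.Base using (Bool; true; false; not; if_then_else_)
import Data.Bool.Properties as Bool
open import Data.Fin.Base using (Fin; zero; suc)
open import Data.List.Base using (List; []; _∷_; map; cartesianProduct)
import Data.List.Extrema as Extrema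
open import Data.List.Membership.Propositional using (_∈_)
open import Data.List.Membership.Propositional.Properties
  using (∈-map⁻; ∈-++⁻; ∈-filter⁻; ∈-cartesianProduct⁺; ∈-cartesianProduct⁻)
import Data.List.Relation.Unary.All as All
import Data.List.Relation.Unary.All.Properties as All
open import Data.Nat.Base using (ℕ; zero; suc)
open import Data.Product.Base using (∃; _×_; _,_; proj₁; proj₂)
open import Data.Sum.Base using (inj₁; inj₂)
open import Data.Vec.Base using (Vec; lookup)
open import Relation.Binary.Bundles using (TotalOrder)
open import Relation.Binary.PropositionalEquality.Core as ≡ using (_≡_)
open import Relation.Nullary.Decidable.Core using (yes; no; does)
open import Relation.Nullary.Negation.Core using (contradiction)

-- Membership in the enumerated domain and in the list of opposite pairs.

∈-domain⁻ : ∀ {n} (f : PartialBoolean n) {b x} →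
            (b , x) ∈ domain f → x ∈ preimages f b
∈-domain⁻ f u∈ with ∈-++⁻ (map (false ,_) (preimages f false)) u∈
... | inj₁ u∈₀ with _ , x∈ , ≡.refl ← ∈-map⁻ (false ,_) u∈₀ = x∈
... | inj₂ u∈₁ with _ , x∈ , ≡.refl ← ∈-map⁻ (true ,_) u∈₁ = x∈

∈-oppositePairs⁻ : ∀ {n} (f : PartialBoolean n) {b b′ x y} →
                   ((b , x) , (b′ , y)) ∈ oppositePairs f →
                   (x ∈ preimages f b × y ∈ preimages f b′) × b ≡ not b′
∈-oppositePairs⁻ f uv∈
  with uv∈′ , b≡ ← ∈-filter⁻ _ {xs = cartesianProduct (domain f) (domain f)} uv∈
  with u∈ , v∈ ← ∈-cartesianProduct⁻ (domain f) (domain f) uv∈′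
  = (∈-domain⁻ f u∈ , ∈-domain⁻ f v∈) , b≡

module _ {c ℓ₁ ℓ₂} (K : OrderedField c ℓ₁ ℓ₂) where

  open OrderedField K
  open Complexity K
  open CommutativeRing commutativeRing
    using (ring; +-cong; +-congˡ; +-comm; +-identityˡ; +-identityʳ; -‿cong; -‿inverseʳ;
           -‿inverseˡ; +-assoc; *-congˡ; *-congʳ; *-assoc; *-comm;
           *-identityˡ; _-_; sym; trans)
  open RingProperties ring using (-‿distribˡ-*; -‿distribʳ-*; -‿involutive; [y-z]x≈yx-zx)
  open Sum +-commutativeMonoid using (sum; sum-cong-≗; ∑-comm)
  open Min totalOrder using (_⊓_; ⊓-glb)
  open TotalOrder totalOrder
    using (refl; antisym; total; ≤-respˡ-≈; ≤-respʳ-≈)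
    renaming (trans to ≤-trans)
  open Distribution using (prob)

  -- Arithmetic of ordered fields and antitonicity of the reciprocal.

  +-mono-≤ : ∀ {x y u v} → x ≤ y → u ≤ v → (x + u) ≤ (y + v)
  +-mono-≤ {x} {y} {u} {v} x≤y u≤v = ≤-trans (+-monoˡ-≤ u x≤y)
    (≤-respˡ-≈ (+-comm u y) (≤-respʳ-≈ (+-comm v y) (+-monoˡ-≤ y u≤v)))

  x≤y⇒0≤y-x : ∀ {x y} → x ≤ y → 0# ≤ (y - x)
  x≤y⇒0≤y-x {x} x≤y = ≤-respˡ-≈ (-‿inverseʳ x) (+-monoˡ-≤ (- x) x≤y)

  0≤y-x⇒x≤y : ∀ {x y} → 0# ≤ (y - x) → x ≤ y
  0≤y-x⇒x≤y {x} {y} 0≤y-x =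
    ≤-respˡ-≈ (+-identityˡ x) (≤-respʳ-≈ cancel (+-monoˡ-≤ x 0≤y-x))
    where
    cancel : ((y - x) + x) ≈ y
    cancel = trans (+-assoc y (- x) x) (trans (+-congˡ (-‿inverseˡ x)) (+-identityʳ y))

  square-nonNegative : ∀ x → 0# ≤ (x * x)
  square-nonNegative x with total 0# x
  ... | inj₁ 0≤x = *-nonNegative 0≤x 0≤x
  ... | inj₂ x≤0 = ≤-respʳ-≈ neg-square (*-nonNegative 0≤-x 0≤-x)
    where
    0≤-x : 0# ≤ (- x)
    0≤-x = ≤-respʳ-≈ (+-identityˡ (- x)) (x≤y⇒0≤y-x x≤0)
    neg-square : (- x * - x) ≈ (x * x)
    neg-square = trans (sym (-‿distribˡ-* x (- x)))
      (trans (-‿cong (sym (-‿distribʳ-* x x)))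
        (-‿involutive (x * x)))

  -- `x⁻¹` equals `x * (x⁻¹ * x⁻¹)`, the product of a nonnegative element and a square.
  inverse-nonNegative : ∀ {x x⁻¹} → 0# ≤ x → (x * x⁻¹) ≈ 1# → 0# ≤ x⁻¹
  inverse-nonNegative {x} {x⁻¹} 0≤x xx⁻¹≈1 = ≤-respʳ-≈
    (trans (sym (*-assoc x x⁻¹ x⁻¹)) (trans (*-congʳ xx⁻¹≈1) (*-identityˡ x⁻¹)))
    (*-nonNegative 0≤x (square-nonNegative x⁻¹))

  -- The difference `x⁻¹ - y⁻¹` factors as `(y - x) * (x⁻¹ * y⁻¹)`, and all three factors are
  -- nonnegative.
  inverse-antitone : ∀ {x x⁻¹ y y⁻¹} → 0# ≤ x → x ≤ y →
                     (x * x⁻¹) ≈ 1# → (y * y⁻¹) ≈ 1# → y⁻¹ ≤ x⁻¹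
  inverse-antitone {x} {x⁻¹} {y} {y⁻¹} 0≤x x≤y xx⁻¹≈1 yy⁻¹≈1 =
    0≤y-x⇒x≤y (≤-respʳ-≈ difference
      (*-nonNegative (x≤y⇒0≤y-x x≤y)
        (*-nonNegative (inverse-nonNegative 0≤x xx⁻¹≈1)
                       (inverse-nonNegative (≤-trans 0≤x x≤y) yy⁻¹≈1))))
    where
    cancelˡ : ∀ {z z⁻¹} w → (z * z⁻¹) ≈ 1# → (z * (z⁻¹ * w)) ≈ w
    cancelˡ {z} {z⁻¹} w zz⁻¹≈1 =
      trans (sym (*-assoc z z⁻¹ w)) (trans (*-congʳ zz⁻¹≈1) (*-identityˡ w))
    difference : ((y - x) * (x⁻¹ * y⁻¹)) ≈ (x⁻¹ - y⁻¹)
    difference = trans ([y-z]x≈yx-zx (x⁻¹ * y⁻¹) y x)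
      (+-cong (trans (*-congˡ (*-comm x⁻¹ y⁻¹)) (cancelˡ x⁻¹ yy⁻¹≈1))
              (-‿cong (cancelˡ y⁻¹ xx⁻¹≈1)))

  reciprocal-antitone : ∀ {x y} → 0# ≤ x → x ≤ y → reciprocal y ≤⁺ reciprocal x
  reciprocal-antitone {x} {y} 0≤x x≤y with x ≟ 0# | y ≟ 0#
  ... | yes _   | yes _   = _ _≤⁺_.≤⊤⁺
  ... | yes _   | no _    = _ _≤⁺_.≤⊤⁺
  -- Here `0# ≤ x ≤ y ≈ 0#` would force `x ≈ 0#`.
  ... | no x≉0  | yes y≈0 = contradiction (antisym (≤-respʳ-≈ y≈0 x≤y) 0≤x) x≉0
  ... | no x≉0  | no y≉0  = _≤⁺_.[ inverse-antitone 0≤x x≤y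
    (proj₂ (proj₂ (invertible x x≉0))) (proj₂ (proj₂ (invertible y y≉0))) ]

  -- Finite sums and sums over differing positions.

  sum-mono-≤ : ∀ {n} {v w : Fin n → Carrier} → (∀ i → v i ≤ w i) → sum v ≤ sum w
  sum-mono-≤ {zero}  v≤w = refl
  sum-mono-≤ {suc n} v≤w = +-mono-≤ (v≤w zero) (sum-mono-≤ (λ i → v≤w (suc i)))

  sum-nonNegative : ∀ {n} {w : Fin n → Carrier} → (∀ i → 0# ≤ w i) → 0# ≤ sum w
  sum-nonNegative {zero}  0≤w = refl
  sum-nonNegative {suc n} 0≤w =
    ≤-respˡ-≈ (+-identityˡ 0#) (+-mono-≤ (0≤w zero) (sum-nonNegative (λ i → 0≤w (suc i))))

  term≤sum : ∀ {n} {w : Fin n → Carrier} → (∀ i → 0# ≤ w i) → ∀ i → w i ≤ sum w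
  term≤sum {suc n} {w} 0≤w zero = ≤-respˡ-≈ (+-identityʳ (w zero))
    (+-mono-≤ refl (sum-nonNegative (λ i → 0≤w (suc i))))
  term≤sum {suc n} {w} 0≤w (suc i) = ≤-respˡ-≈ (+-identityˡ (w (suc i)))
    (+-mono-≤ (0≤w zero) (term≤sum (λ j → 0≤w (suc j)) i))

  sumDiffering-nonNegative : ∀ {n} (x y : Vec Bool n) {w} → (∀ i → 0# ≤ w i) →
                             0# ≤ sumDiffering x y w
  sumDiffering-nonNegative x y {w} 0≤w = sum-nonNegative term
    where
    term : ∀ i → 0# ≤ (if does (lookup x i Bool.≟ lookup y i) then 0# else w i)
    term i with does (lookup x i Bool.≟ lookup y i)
    ... | true  = refl
    ... | false = 0≤w i

  sumDiffering-mono-≤ : ∀ {n} (x y : Vec Bool n) {v w} → (∀ i → v i ≤ w i) →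
                        sumDiffering x y v ≤ sumDiffering x y w
  sumDiffering-mono-≤ x y {v} {w} v≤w = sum-mono-≤ term
    where
    term : ∀ i → (if does (lookup x i Bool.≟ lookup y i) then 0# else v i)
               ≤ (if does (lookup x i Bool.≟ lookup y i) then 0# else w i)
    term i with does (lookup x i Bool.≟ lookup y i)
    ... | true  = refl
    ... | false = v≤w i

  -- Opposite pairs occur in both orders, whereas a strategy always takes the 0-input first; this
  -- symmetry reconciles the two.
  sumDiffering-comm : ∀ {n} (x y : Vec Bool n) w → sumDiffering x y w ≡ sumDiffering y x w
  sumDiffering-comm x y w = sum-cong-≗ λ i →
    ≡.cong (if_then 0# else w i) (does-≟-comm (lookup x i) (lookup y i))
    where
    does-≟-comm : ∀ a b → does (a Bool.≟ b) ≡ does (b Bool.≟ a)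
    does-≟-comm false false = ≡.refl
    does-≟-comm false true  = ≡.refl
    does-≟-comm true  false = ≡.refl
    does-≟-comm true  true  = ≡.refl

  -- Marginals of joint distributions.

  firstMarginal : ∀ {n} → JointDistribution n → Distribution n
  firstMarginal J = record
    { prob        = λ a → sum (J.prob a)
    ; nonNegative = λ a → sum-nonNegative (J.nonNegative a)
    ; total       = J.total
    } where module J = JointDistribution J

  -- Swapping the players turns statements about the second marginal into statements about the
  -- first.
  transpose : ∀ {n} → JointDistribution n → JointDistribution n
  transpose J = record
    { prob        = λ a b → J.prob b a
    ; nonNegative = λ a b → J.nonNegative b a
    ; total       = trans (sym (∑-comm J.prob)) J.total
    } where module J = JointDistribution J

  secondMarginal : ∀ {n} → JointDistribution n → Distribution n
  secondMarginal J = firstMarginal (transpose J)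

  -- The diagonal entry is one of the nonnegative terms of its row sum.
  diagonal≤firstMarginal : ∀ {n} (J : JointDistribution n) i →
                           JointDistribution.prob J i i ≤ prob (firstMarginal J) i
  diagonal≤firstMarginal J i = term≤sum (JointDistribution.nonNegative J i) i

  -- From a non-signaling strategy to an assignment of distributions.

  module _ {n : ℕ} (f : PartialBoolean n) where

    -- The two lists are parameters so that `dominating` can split on whether they are empty; an
    -- empty list makes the condition vacuous.
    Dominates : List (Preimage f false) → List (Preimage f true) →
                (Domain f → Distribution n) → NonSignalingStrategy f → Set _
    Dominates xs ys q s = ∀ {x y} → x ∈ xs → y ∈ ys → ∀ i →
      p i i x y ≤ prob (q (false , x)) i × p i i x y ≤ prob (q (true , y)) i
      where open NonSignalingStrategy s

    -- The fallback covers constant f, where x₀ or y₀ does not exist and there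
    -- is nothing to dominate.
    dominating : (fallback : Domain f → Distribution n) (s : NonSignalingStrategy f) →
                 ∀ xs ys → ∃ λ q → Dominates xs ys q s
    dominating fallback s []       ys       = fallback , λ ()
    dominating fallback s (_ ∷ _)  []       = fallback , λ _ ()
    dominating fallback s (x₀ ∷ _) (y₀ ∷ _) = q , λ {x} {y} _ _ i →
        -- Each diagonal entry is bounded by a marginal of `joint x y` itself; non-signaling then
        -- replaces `y` by `y₀`, and on the next line `x` by `x₀`.
        ≤-respʳ-≈ (marginalˡ x y y₀ i) (diagonal≤firstMarginal (joint x y) i)
      , ≤-respʳ-≈ (marginalʳ x x₀ y i) (diagonal≤firstMarginal (transpose (joint x y)) i)
      where
      open NonSignalingStrategy s
      q : Domain f → Distribution n
      q (false , x) = firstMarginal (joint x y₀)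
      q (true  , y) = secondMarginal (joint x₀ y)

    -- Comparison of the two costs for a dominating assignment.

    module _ (q : Domain f → Distribution n) (s : NonSignalingStrategy f)
             (dom : Dominates (preimages f false) (preimages f true) q s) where

      open NonSignalingStrategy s
      open Extrema totalOrder∞ using (max≤v⁺; ⊥≤max; xs≤max)
      open TotalOrder totalOrder∞ using () renaming (trans to ≤⁺-trans)

      win : Preimage f false → Preimage f true → Carrier
      win x y = sumDiffering (proj₁ x) (proj₁ y) (λ i → p i i x y)

      agreement : Domain f → Domain f → Carrier
      agreement u v =
        sumDiffering (proj₁ (proj₂ u)) (proj₁ (proj₂ v)) (λ i → prob (q u) i ⊓ prob (q v) i)

      reciprocal-win≤cost : ∀ {x y} → x ∈ preimages f false → y ∈ preimages f true →
                            reciprocal (win x y) ≤⁺ CGⁿˢ-cost f s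
      reciprocal-win≤cost x∈ y∈ =
        All.lookup (All.map⁻ (xs≤max _ (map _ (cartesianProduct (preimages f false) (preimages f true)))))
          (∈-cartesianProduct⁺ x∈ y∈)

      win-nonNegative : ∀ x y → 0# ≤ win x y
      win-nonNegative x y = sumDiffering-nonNegative (proj₁ x) (proj₁ y)
        (λ i → JointDistribution.nonNegative (joint x y) i i)

      -- Domination places the pointwise minimum above `p i i x y`, so the agreement is at least the
      -- winning probability; taking reciprocals reverses the inequality.
      reciprocal-agreement≤cost : ∀ {u v} → (u , v) ∈ oppositePairs f →
                                reciprocal (agreement u v) ≤⁺ CGⁿˢ-cost f s
      reciprocal-agreement≤cost {false , x} {true , y} uv∈
        with (x∈ , y∈) , _ ← ∈-oppositePairs⁻ f uv∈
        = ≤⁺-trans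
          (reciprocal-antitone (win-nonNegative x y)
            (sumDiffering-mono-≤ (proj₁ x) (proj₁ y)
              (λ i → ⊓-glb (proj₁ (dom x∈ y∈ i)) (proj₂ (dom x∈ y∈ i)))))
          (reciprocal-win≤cost x∈ y∈)
      reciprocal-agreement≤cost {true , y} {false , x} uv∈
        with (y∈ , x∈) , _ ← ∈-oppositePairs⁻ f uv∈
        = ≤⁺-trans
          (reciprocal-antitone (win-nonNegative x y)
            -- The 1-input comes first in this pair, so the sum over differing positions is turned
            -- around to become `win x y`.
            (≡.subst (_≤ agreement (true , y) (false , x))
              (sumDiffering-comm (proj₁ y) (proj₁ x) (λ i → p i i x y))
              (sumDiffering-mono-≤ (proj₁ y) (proj₁ x)
                (λ i → ⊓-glb (proj₂ (dom x∈ y∈ i)) (proj₁ (dom x∈ y∈ i))))))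
          (reciprocal-win≤cost x∈ y∈)
      -- Two inputs of equal value would give `b ≡ not b`.
      reciprocal-agreement≤cost {false , _} {false , _} uv∈ with () ← proj₂ (∈-oppositePairs⁻ f uv∈)
      reciprocal-agreement≤cost {true , _}  {true , _}  uv∈ with () ← proj₂ (∈-oppositePairs⁻ f uv∈)

      CMM-cost≤CGⁿˢ-cost : CMM-cost f q ≤⁺ CGⁿˢ-cost f s
      CMM-cost≤CGⁿˢ-cost = max≤v⁺
        -- The maximum in `CMM-cost` starts from `[ 0# ]`, so this starting value must be bounded as
        -- well; `CGⁿˢ-cost` is a maximum with the same start.
        (⊥≤max _ (map _ (cartesianProduct (preimages f false) (preimages f true))))
        (All.map⁺ (All.tabulate reciprocal-agreement≤cost))

theorem6p2 : ∀ {c ℓ₁ ℓ₂} (K : OrderedField c ℓ₁ ℓ₂) (let open Complexity K)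
    {n : ℕ} (f : PartialBoolean n) (cmm cg : K∞) →
    IsCMM f cmm → IsCGⁿˢ f cg → cmm ≤⁺ cg
theorem6p2 K f cmm cg ((fallback , _) , cmm-lower) ((s , cost≈cg) , _)
  -- The fallback is the assignment attaining `cmm`: for `n = 0` there is no distribution on
  -- `Fin n`, so one cannot be built for every `n`. The strategy `s` attains `cg`, and the
  -- minimality of `cmm` is applied to `q`.
  with q , dom ← dominating K f fallback s (preimages f false) (preimages f true)
  = ≤-respʳ-≈ cost≈cg (≤-trans (cmm-lower q) (CMM-cost≤CGⁿˢ-cost K f q s dom))
  where
  open Complexity K
  open TotalOrder totalOrder∞ using (≤-respʳ-≈) renaming (trans to ≤-trans)
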